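{- Let $(G,s,t)$ be a minimal weak link of weight $w$, and let $p$ be the number of its centre vertices. Then every border vertex $b$ (a non-terminal vertex adjacent to $s$ or to $t$) has degree $d_b\le p+2$ if $w>3$, and $d_b\le p+1$ if $w>5$.
   Context: A Shannon game (link) $(G,s,t)$ consists of a finite simple graph $G$ and two distinct designated vertices $s,t$, the terminals. Two players, Short and Cut, alternately select a not-yet-selected non-terminal vertex; Short claims his vertices, Cut deletes his. Short wins if at the end there is an $s$–$t$ path all of whose internal vertices are claimed by Short; otherwise Cut wins. The link is strong if Short has a winning strategy when moving second, and weak if Short has a winning strategy when moving first but not when moving second. A weak link is minimal if deleting any single edge of $G$ produces a game in which Short has no winning strategy as first player. The weight $w$ is the number of non-terminal vertices. The borders are $B_s=\Gamma(s)$ and $B_t=\Gamma(t)$; a border vertex is a vertex of $B_s\cup B_t$. The centre is the set of vertices that are neither terminals nor in $B_s\cup B_t$, and $p$ is its size. -}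

module Defs where

open import Data.Nat using (ℕ; _+_; _∸_; _≤_; _<_)
open import Data.Bool using (Bool; true; false; if_then_else_; _∨_; _∧_; not)
open import Data.Fin using (Fin; _≟_)
open import Data.List using (List; length; filterᵇ; allFin)
open import Data.Product using (_×_; ∃)
open import Relation.Nullary using (¬_; does)
open import Relation.Binary.PropositionalEquality using (_≡_; _≢_)

record Graph : Set where
  field
    n       : ℕ
    adj     : Fin n → Fin n → Bool
    sym     : ∀ u v → adj u v ≡ adj v u
    irrefl  : ∀ v → adj v v ≡ false
open Graph public

deleteEdge : {n : ℕ} → (Fin n → Fin n → Bool) → Fin n → Fin n → (Fin n → Fin n → Bool)
deleteEdge adj a b u v =
  if (does (u ≟ a) ∧ does (v ≟ b)) ∨ (does (u ≟ b) ∧ does (v ≟ a))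
  then false else adj u v

data Label : Set where
  free short cut : Label

data Player : Set where
  Short Cut : Player

State : ℕ → Set
State n = Fin n → Label

_[_↦_] : {n : ℕ} → State n → Fin n → Label → State n
(σ [ v ↦ l ]) u = if does (u ≟ v) then l else σ u

data Conn {n : ℕ} (adj : Fin n → Fin n → Bool) (σ : State n) (x : Fin n) : Fin n → Set where
  here : Conn adj σ x x
  step : ∀ {v w} → Conn adj σ x v → adj v w ≡ true → σ w ≡ short → Conn adj σ x w

data ShortWins {n : ℕ} (adj : Fin n → Fin n → Bool) (s t : Fin n) : State n → Player → Set where
  finished  : ∀ {σ p} → (∀ v → σ v ≢ free) → Conn adj σ s t → ShortWins adj s t σ p
  shortMove : ∀ {σ} v → σ v ≡ free → ShortWins adj s t (σ [ v ↦ short ]) Cut → ShortWins adj s t σ Short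
  cutMove   : ∀ {σ} → ∃ (λ v → σ v ≡ free) →
              (∀ v → σ v ≡ free → ShortWins adj s t (σ [ v ↦ cut ]) Short) →
              ShortWins adj s t σ Cut

initial : {n : ℕ} → Fin n → Fin n → State n
initial s t v = if does (v ≟ s) ∨ does (v ≟ t) then short else free

ShortWinsFirst : {n : ℕ} → (Fin n → Fin n → Bool) → Fin n → Fin n → Set
ShortWinsFirst adj s t = ShortWins adj s t (initial s t) Short

ShortWinsSecond : {n : ℕ} → (Fin n → Fin n → Bool) → Fin n → Fin n → Set
ShortWinsSecond adj s t = ShortWins adj s t (initial s t) Cut

WeakLink : (G : Graph) → Fin (n G) → Fin (n G) → Set
WeakLink G s t = ShortWinsFirst (adj G) s t × ¬ ShortWinsSecond (adj G) s t

MinimalWeakLink : (G : Graph) → Fin (n G) → Fin (n G) → Set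
MinimalWeakLink G s t = WeakLink G s t ×
  (∀ a b → adj G a b ≡ true → ¬ ShortWinsFirst (deleteEdge (adj G) a b) s t)

count : {n : ℕ} → (Fin n → Bool) → ℕ
count {n} P = length (filterᵇ P (allFin n))

weight : Graph → ℕ
weight G = n G ∸ 2

degree : (G : Graph) → Fin (n G) → ℕ
degree G v = count (adj G v)

isTerminal : (G : Graph) → Fin (n G) → Fin (n G) → Fin (n G) → Bool
isTerminal G s t v = does (v ≟ s) ∨ does (v ≟ t)

isBorder : (G : Graph) → Fin (n G) → Fin (n G) → Fin (n G) → Bool
isBorder G s t v = not (isTerminal G s t v) ∧ (adj G s v ∨ adj G t v)

isCentre : (G : Graph) → Fin (n G) → Fin (n G) → Fin (n G) → Bool
isCentre G s t v = not (isTerminal G s t v) ∧ not (adj G s v ∨ adj G t v)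

centreSize : (G : Graph) → Fin (n G) → Fin (n G) → ℕ
centreSize G s t = count (isCentre G s t)

{-# OPTIONS --safe #-}

-- If Short wins inside a vertex set L, by a first move followed by a pairing strategy, then
-- minimality makes every vertex outside L isolated, hence central. By symmetry let b be
-- adjacent to s. If b is adjacent to t or to two neighbours of t, Short wins inside at most
-- five vertices and b has at most three neighbours. Otherwise the neighbours of b are s,
-- central vertices and at most one neighbour c of t, so its degree is at most p + 2, and it
-- is at most p + 1 unless c exists and b is adjacent to the whole centre.
--
-- In that case, for w > 5, Short cannot win inside L with s, t in L and |L| ≤ 7: a vertex
-- outside L would be isolated, yet central and so adjacent to b. Excluding such small wins
-- shows that the edges from Γ(s) and the centre to Γ(t) \ {c} form a matching, which by
-- minimality of the edges from b covers the centre, and that b is the only neighbour of c in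
-- Γ(s). A path from Γ(s) \ {b} through the centre to c would let Short win without the edge
-- b c; if there is none, Cut wins as second player by pairing along the matching and b c.
module Submission where

open import Defs
open import Data.Nat using (ℕ; zero; suc; _+_; _∸_; _≤_; _<_; z≤n; s≤s)
open import Data.Nat.Properties as ℕₚ using (≤-refl; ≤-trans)
open import Data.Fin using (Fin; _≟_)
open import Data.Fin.Properties using (any?)
open import Data.Bool using (Bool; true; false; _∨_; _∧_)
open import Data.Bool.Properties as 𝔹ₚ using (T-≡; ∨-comm)
open import Data.List using (List; []; _∷_; length; filterᵇ; allFin; _++_)
open import Data.List.Properties using (length-++; length-tabulate)
open import Data.List.Membership.Propositional using (_∈_; _∉_)
open import Data.List.Membership.Propositional.Properties
  using (∈-∃++; ∈-++⁺ˡ; ∈-++⁺ʳ; ∈-++⁻; ∈-filter⁺; ∈-filter⁻; ∈-allFin; ∈-AllPairs₂)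
import Data.List.Membership.DecPropositional as DecMembership
open import Data.List.Relation.Unary.Any using (here; there)
open import Data.List.Relation.Unary.All as All using (All; []; _∷_)
open import Data.List.Relation.Unary.AllPairs using (AllPairs; []; _∷_)
open import Data.List.Relation.Unary.Unique.Propositional using (Unique)
open import Data.List.Relation.Unary.Unique.Propositional.Properties
  using (Unique[x∷xs]⇒x∉xs)
import Data.List.Relation.Unary.Unique.Propositional.Properties as Uniqueₚ
open import Data.Product using (_×_; _,_; proj₁; proj₂; ∃)
open import Data.Product.Properties using (≡-dec)
open import Data.Sum using (_⊎_; inj₁; inj₂; [_,_]′)
open import Data.Empty using (⊥; ⊥-elim)
open import Function using (_∘_; id; case_of_)
open import Function.Bundles using (Equivalence)
open import Relation.Nullary using (¬_; Dec; yes; no; does; contradiction; decidable-stable)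
open import Relation.Nullary.Decidable
  using (_×-dec_; _→-dec_; _⊎-dec_; ¬?; dec-true; dec-false; T?)
open import Relation.Binary.PropositionalEquality
  using (_≡_; _≢_; refl; trans; cong; subst; subst₂) renaming (sym to ≡-sym)

-- Counting

-- Induction on `xs`: one occurrence of the head is cut out of `ys`, and uniqueness ensures that the
-- tail still embeds in what is left.
unique-⊆⇒length-≤ : {A : Set} {xs ys : List A} → Unique xs → (∀ {x} → x ∈ xs → x ∈ ys) →
  length xs ≤ length ys
unique-⊆⇒length-≤ [] _ = z≤n
unique-⊆⇒length-≤ {xs = x ∷ xs} (x≢ ∷ uniq) ⊆ with ∈-∃++ (⊆ (here refl))
... | as , bs , refl = subst (suc (length xs) ≤_) (≡-sym length-middle)
      (s≤s (unique-⊆⇒length-≤ uniq remove))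
  where
  length-middle : length (as ++ x ∷ bs) ≡ suc (length (as ++ bs))
  length-middle = trans (length-++ as)
    (trans (ℕₚ.+-suc (length as) (length bs)) (cong suc (≡-sym (length-++ as))))
  remove : ∀ {z} → z ∈ xs → z ∈ as ++ bs
  remove z∈ with ∈-++⁻ as (⊆ (there z∈))
  ... | inj₁ z∈as = ∈-++⁺ˡ z∈as
  ... | inj₂ (here refl) = contradiction refl (All.lookup x≢ z∈)
  ... | inj₂ (there z∈bs) = ∈-++⁺ʳ as z∈bs

module _ {m : ℕ} where
  open DecMembership (_≟_ {m}) public using (_∈?_)

-- Pigeonhole: otherwise the duplicate-free list of all vertices would embed in `L`.
fresh : ∀ {m} (L : List (Fin m)) → length L < m → ∃ λ u → u ∉ L
fresh {m} L L<m with any? (λ u → ¬? (u ∈? L))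
... | yes u = u
... | no none = contradiction
      (subst (_≤ length L) (length-tabulate {n = m} id)
        (unique-⊆⇒length-≤ (Uniqueₚ.allFin⁺ m)
          (λ {u} _ → decidable-stable (u ∈? L) (λ u∉ → none (u , u∉)))))
      (ℕₚ.<⇒≱ L<m)

module _ {m : ℕ} (P : Fin m → Bool) where

  ∈-filterᵇ⁺ : ∀ {u} → P u ≡ true → u ∈ filterᵇ P (allFin m)
  ∈-filterᵇ⁺ {u} Pu = ∈-filter⁺ (T? ∘ P) (∈-allFin u) (Equivalence.from T-≡ Pu)

  ∈-filterᵇ⁻ : ∀ {u} → u ∈ filterᵇ P (allFin m) → P u ≡ true
  ∈-filterᵇ⁻ u∈ = Equivalence.to T-≡ (proj₂ (∈-filter⁻ (T? ∘ P) {xs = allFin m} u∈))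

-- `L` collects the possible exceptions to `P` implying `Q`, and `M` is known slack, in `Q` but not
-- in `P`. The duplicate-free list of `P` followed by `M` embeds in the list of `Q` followed by `L`.
count-≤ : ∀ {m} (P Q : Fin m → Bool) (M L : List (Fin m)) → Unique M →
  (∀ {u} → u ∈ M → Q u ≡ true × P u ≡ false) →
  (∀ u → P u ≡ true → Q u ≡ true ⊎ u ∈ L) →
  count P + length M ≤ count Q + length L
count-≤ {m} P Q M L uniqM M⊆ P⊆ =
  subst₂ _≤_ (length-++ FP) (length-++ FQ)
    (unique-⊆⇒length-≤
      (Uniqueₚ.++⁺ (Uniqueₚ.filter⁺ (T? ∘ P) (Uniqueₚ.allFin⁺ m)) uniqM
        λ (u∈P , u∈M) → case trans (≡-sym (∈-filterᵇ⁻ P u∈P)) (proj₂ (M⊆ u∈M)) of λ ())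
      sub)
  where
  FP = filterᵇ P (allFin m)
  FQ = filterᵇ Q (allFin m)
  sub : ∀ {u} → u ∈ FP ++ M → u ∈ FQ ++ L
  sub {u} u∈ with ∈-++⁻ FP u∈
  ... | inj₂ u∈M = ∈-++⁺ˡ (∈-filterᵇ⁺ Q (proj₁ (M⊆ u∈M)))
  ... | inj₁ u∈P with P⊆ u (∈-filterᵇ⁻ P u∈P)
  ...   | inj₁ Qu = ∈-++⁺ˡ (∈-filterᵇ⁺ Q Qu)
  ...   | inj₂ u∈L = ∈-++⁺ʳ FQ u∈L

count-cong : ∀ {m} {P Q : Fin m → Bool} → (∀ u → P u ≡ Q u) → count P ≡ count Q
count-cong {P = P} {Q} P≗Q = ℕₚ.≤-antisym (le P Q P≗Q) (le Q P (≡-sym ∘ P≗Q))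
  where
  le : ∀ P Q → (∀ u → P u ≡ Q u) → count P ≤ count Q
  le P Q P≗Q = subst₂ _≤_ (ℕₚ.+-identityʳ _) (ℕₚ.+-identityʳ _)
    (count-≤ P Q [] [] [] (λ ()) (λ u Pu → inj₁ (trans (≡-sym (P≗Q u)) Pu)))

-- Positions and pairing strategies

_≟ˡ_ : (k l : Label) → Dec (k ≡ l)
free ≟ˡ free = yes refl
free ≟ˡ short = no λ ()
free ≟ˡ cut = no λ ()
short ≟ˡ free = no λ ()
short ≟ˡ short = yes refl
short ≟ˡ cut = no λ ()
cut ≟ˡ free = no λ ()
cut ≟ˡ short = no λ ()
cut ≟ˡ cut = yes refl

free/short/cut : ∀ l → l ≡ free ⊎ l ≡ short ⊎ l ≡ cut
free/short/cut free = inj₁ refl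
free/short/cut short = inj₂ (inj₁ refl)
free/short/cut cut = inj₂ (inj₂ refl)

free/cut/short : ∀ l → l ≡ free ⊎ l ≡ cut ⊎ l ≡ short
free/cut/short free = inj₁ refl
free/cut/short cut = inj₂ (inj₁ refl)
free/cut/short short = inj₂ (inj₂ refl)

module _ {m : ℕ} where

  update-same : (σ : State m) (v : Fin m) (l : Label) → (σ [ v ↦ l ]) v ≡ l
  update-same σ v l rewrite dec-true (v ≟ v) refl = refl

  update-other : (σ : State m) {u v : Fin m} (l : Label) → u ≢ v → (σ [ v ↦ l ]) u ≡ σ u
  update-other σ {u} {v} l u≢v rewrite dec-false (u ≟ v) u≢v = refl

  update-cong : {σ τ : State m} (v : Fin m) (l : Label) → (∀ u → σ u ≡ τ u) →
    ∀ u → (σ [ v ↦ l ]) u ≡ (τ [ v ↦ l ]) u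
  update-cong v l σ≗τ u with does (u ≟ v)
  ... | true = refl
  ... | false = σ≗τ u

  update-keeps : (σ : State m) {u v : Fin m} {l : Label} → σ v ≡ free → σ u ≢ free →
    (σ [ v ↦ l ]) u ≡ σ u
  update-keeps σ v-free u-set = update-other σ _ λ { refl → u-set v-free }

  _⊑_ : State m → State m → Set
  σ ⊑ ρ = ∀ v → σ v ≢ free → ρ v ≡ σ v

  update-⊑ : (σ : State m) {v : Fin m} (l : Label) → σ v ≡ free → σ ⊑ (σ [ v ↦ l ])
  update-⊑ σ l v-free u = update-keeps σ v-free

  ⊑-trans : {σ τ ρ : State m} → σ ⊑ τ → τ ⊑ ρ → σ ⊑ ρ
  ⊑-trans σ⊑τ τ⊑ρ v v-set =
    trans (τ⊑ρ v (λ e → v-set (trans (≡-sym (σ⊑τ v v-set)) e))) (σ⊑τ v v-set)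

  isFree : State m → Fin m → Bool
  isFree σ v = does (σ v ≟ˡ free)

  isFree-true : (σ : State m) {v : Fin m} → σ v ≡ free → isFree σ v ≡ true
  isFree-true σ {v} = dec-true (σ v ≟ˡ free)

  isFree⇒free : (σ : State m) {v : Fin m} → isFree σ v ≡ true → σ v ≡ free
  isFree⇒free σ {v} e with σ v ≟ˡ free
  ... | yes v-free = v-free

  -- The number of free vertices is the termination measure for building Short's strategies.
  free-decreases : (σ : State m) {v : Fin m} {l : Label} → σ v ≡ free → l ≢ free →
    count (isFree (σ [ v ↦ l ])) < count (isFree σ)
  free-decreases σ {v} {l} v-free l≢free = subst₂ _≤_ (ℕₚ.+-comm _ 1) (ℕₚ.+-identityʳ _)
    (count-≤ (isFree (σ [ v ↦ l ])) (isFree σ) (v ∷ []) [] ([] ∷ [])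
      (λ { (here refl) → isFree-true σ v-free
                       , dec-false (_ ≟ˡ free) (l≢free ∘ trans (≡-sym (update-same σ v l))) })
      (λ u u-free → inj₁ (isFree-true σ (still-free u (isFree⇒free (σ [ v ↦ l ]) u-free)))))
    where
    still-free : ∀ u → (σ [ v ↦ l ]) u ≡ free → σ u ≡ free
    still-free u u-free = decidable-stable (σ u ≟ˡ free) λ u-set →
      u-set (trans (≡-sym (update-keeps σ v-free u-set)) u-free)

  free? : (σ : State m) → Dec (∃ λ v → σ v ≡ free)
  free? σ = any? (λ v → σ v ≟ˡ free)

-- A relation instead of a list of pairs, so that a pairing can also be read off from adjacency.
-- `partner?` makes the reply to a move computable.
record Pairing (m : ℕ) : Set₁ where
  field
    Paired     : Fin m → Fin m → Set
    symmetric  : ∀ {x y} → Paired x y → Paired y x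
    functional : ∀ {x y y′} → Paired x y → Paired x y′ → y ≡ y′
    irreflexive : ∀ {x} → ¬ Paired x x
    partner?   : ∀ x → Dec (∃ (Paired x))

  -- The invariant of a pairing strategy, with `k` the label of the opponent and `l` that of the
  -- pairing player. Keeping both as parameters serves Short and Cut alike.
  Answered : Label → Label → State m → Set
  Answered k l σ = ∀ x y → Paired x y → σ x ≡ k → σ y ≡ l

  module _ {k l : Label} (k≢l : k ≢ l) (l≢free : l ≢ free)
    (labels : ∀ a → a ≡ free ⊎ a ≡ k ⊎ a ≡ l) where

    answer-partner : ∀ {σ x y} → σ x ≡ free → σ y ≡ free → Paired x y → Answered k l σ →
      Answered k l ((σ [ x ↦ k ]) [ y ↦ l ])
    answer-partner {σ} {x} {y} x-free y-free xy ans u v uv uk = by-cases (u ≟ y) (u ≟ x)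
      where
      by-cases : Dec (u ≡ y) → Dec (u ≡ x) → ((σ [ x ↦ k ]) [ y ↦ l ]) v ≡ l
      by-cases (yes refl) _ =
        contradiction (trans (≡-sym uk) (update-same (σ [ x ↦ k ]) y l)) k≢l
      by-cases (no _) (yes refl) with refl ← functional uv xy =
        update-same (σ [ x ↦ k ]) y l
      by-cases (no u≢y) (no u≢x) =
        trans (update-other (σ [ x ↦ k ]) l v≢y) (trans (update-other σ k v≢x) vl)
        where
        vl : σ v ≡ l
        vl = ans u v uv (trans (≡-sym (trans (update-other (σ [ x ↦ k ]) l u≢y)
                                         (update-other σ k u≢x))) uk)
        v≢y : v ≢ y
        v≢y refl = u≢x (functional (symmetric uv) (symmetric xy))
        v≢x : v ≢ x
        v≢x refl = u≢y (functional (symmetric uv) xy)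

    -- A partner of the free vertex `x` cannot carry `k`, for then `x` would already carry `l`. Not
    -- being free, it carries `l`.
    partner-taken : ∀ {σ x} → σ x ≡ free → (∀ {y} → Paired x y → σ y ≢ free) → Answered k l σ →
      Answered k l (σ [ x ↦ k ])
    partner-taken {σ} {x} x-free taken ans u v uv uk = by-cases (u ≟ x)
      where
      by-cases : Dec (u ≡ x) → (σ [ x ↦ k ]) v ≡ l
      by-cases (yes refl) with labels (σ v)
      ... | inj₁ v-free = contradiction v-free (taken uv)
      ... | inj₂ (inj₁ vk) =
        contradiction (trans (≡-sym (ans v u (symmetric uv) vk)) x-free) l≢free
      ... | inj₂ (inj₂ vl) = trans (update-keeps σ x-free (taken uv)) vl
      by-cases (no u≢x) =
        trans (update-keeps σ x-free (λ v-free → l≢free (trans (≡-sym vl) v-free))) vl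
        where
        vl : σ v ≡ l
        vl = ans u v uv (trans (≡-sym (update-other σ k u≢x)) uk)

    extra-move : ∀ {σ x} → σ x ≡ free → Answered k l σ → Answered k l (σ [ x ↦ l ])
    extra-move {σ} {x} x-free ans u v uv uk = by-cases (u ≟ x)
      where
      by-cases : Dec (u ≡ x) → (σ [ x ↦ l ]) v ≡ l
      by-cases (yes refl) = contradiction (trans (≡-sym uk) (update-same σ x l)) k≢l
      by-cases (no u≢x) =
        trans (update-keeps σ x-free (λ v-free → l≢free (trans (≡-sym vl) v-free))) vl
        where
        vl : σ v ≡ l
        vl = ans u v uv (trans (≡-sym (update-other σ l u≢x)) uk)

    -- The second alternative is the end of the game: the opponent has just taken the last free
    -- vertex.
    Reply : State m → Set
    Reply τ = (∃ λ y → τ y ≡ free × Answered k l (τ [ y ↦ l ])) ⊎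
              ((∀ y → τ y ≢ free) × Answered k l τ)

    any-reply : ∀ {τ} → Answered k l τ → Reply τ
    any-reply {τ} ans with free? τ
    ... | yes (y , y-free) = inj₁ (y , y-free , extra-move y-free ans)
    ... | no full = inj₂ ((λ y y-free → full (y , y-free)) , ans)

    -- The partner is taken if it is free; otherwise any free vertex will do, as an extra move never
    -- breaks the invariant.
    reply : ∀ {σ x} → σ x ≡ free → Answered k l σ → Reply (σ [ x ↦ k ])
    reply {σ} {x} x-free ans with partner? x
    ... | no none =
      any-reply (partner-taken x-free (λ xy → contradiction (_ , xy) none) ans)
    ... | yes (y , xy) with σ y ≟ˡ free
    ...   | yes y-free = inj₁ (y , trans (update-other σ k y≢x) y-free ,
                               answer-partner x-free y-free xy ans)
      where
      y≢x : y ≢ x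
      y≢x refl = irreflexive xy
    ...   | no y-set = any-reply (partner-taken x-free
              (λ xy′ → subst (λ z → σ z ≢ free) (functional xy xy′) y-set) ans)

open Pairing

-- Strategies obtained from pairings

module _ {m : ℕ} {adj : Fin m → Fin m → Bool} {s t : Fin m} (P : Pairing m) where

  -- Induction on Short's winning tree: the branch of Cut's replies by `reply` keeps the invariant
  -- and ends in a position that `blocked` refutes.
  cut-pairing-strategy : (∀ ρ → Answered P short cut ρ → ¬ Conn adj ρ s t) →
    ∀ {σ} → Answered P short cut σ → ¬ ShortWins adj s t σ Short
  cut-pairing-strategy blocked ans (finished _ c) = blocked _ ans c
  cut-pairing-strategy blocked ans (shortMove v v-free win)
    with reply P {short} {cut} (λ ()) (λ ()) free/short/cut v-free ans | win
  ... | inj₁ (y , y-free , ans′) | cutMove _ win′ =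
    cut-pairing-strategy blocked ans′ (win′ y y-free)
  ... | inj₁ (y , y-free , _) | finished full _ = full y y-free
  ... | inj₂ (full , _) | cutMove (y , y-free) _ = full y y-free
  ... | inj₂ (_ , ans′) | finished _ c = blocked _ ans′ c

  -- A winning tree has to be constructed, so the recursion runs on a bound `k` for the number of
  -- free vertices. At the end Cut cannot hold both members of a pair.
  short-pairing-strategy : ∀ {σ} →
    (∀ ρ → σ ⊑ ρ → (∀ {x y} → Paired P x y → ρ x ≡ short ⊎ ρ y ≡ short) → Conn adj ρ s t) →
    Answered P cut short σ → ShortWins adj s t σ Cut
  short-pairing-strategy {σ₀} connected = play _ ≤-refl (λ _ _ → refl)
    where
    connected-at-end : ∀ {σ} → (∀ v → σ v ≢ free) → σ₀ ⊑ σ → Answered P cut short σ →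
      Conn adj σ s t
    connected-at-end {σ} full σ₀⊑σ ans = connected σ σ₀⊑σ hit
      where
      hit : ∀ {x y} → Paired P x y → σ x ≡ short ⊎ σ y ≡ short
      hit {x} xy with free/cut/short (σ x)
      ... | inj₁ x-free = contradiction x-free (full x)
      ... | inj₂ (inj₁ x-cut) = inj₂ (ans _ _ xy x-cut)
      ... | inj₂ (inj₂ x-short) = inj₁ x-short

    play : ∀ k {σ} → count (isFree σ) ≤ k → σ₀ ⊑ σ → Answered P cut short σ →
      ShortWins adj s t σ Cut
    play k {σ} bound σ₀⊑σ ans with free? σ
    ... | no full = finished full′ (connected-at-end full′ σ₀⊑σ ans)
      where
      full′ : ∀ v → σ v ≢ free
      full′ v v-free = full (v , v-free)
    play zero {σ} bound σ₀⊑σ ans | yes (v , v-free) =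
      contradiction (≤-trans (free-decreases σ {l = cut} v-free (λ ())) bound) (λ ())
    play (suc k) {σ} bound σ₀⊑σ ans | yes some = cutMove some after-cut
      where
      after-cut : ∀ v → σ v ≡ free → ShortWins adj s t (σ [ v ↦ cut ]) Short
      after-cut v v-free with reply P {cut} {short} (λ ()) (λ ()) free/cut/short v-free ans
      ... | inj₂ (full , ans′) = finished full
              (connected-at-end full (⊑-trans σ₀⊑σ (update-⊑ σ cut v-free)) ans′)
      ... | inj₁ (y , y-free , ans′) = shortMove y y-free
              (play k
                -- A round uses up two free vertices while the bound drops by one, so one strict
                -- decrease is weakened.
                (ℕₚ.≤-pred (≤-trans (s≤s (ℕₚ.<⇒≤ (free-decreases (σ [ v ↦ cut ]) y-free (λ ()))))
                  (≤-trans (free-decreases σ v-free (λ ())) bound)))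
                (⊑-trans σ₀⊑σ (⊑-trans (update-⊑ σ cut v-free) (update-⊑ (σ [ v ↦ cut ]) short y-free)))
                ans′)

-- Pairings from lists of disjoint pairs

_∋_ : ∀ {m} → Fin m × Fin m → Fin m → Set
(x , y) ∋ v = v ≡ x ⊎ v ≡ y

DisjointPairs : ∀ {m} → Fin m × Fin m → Fin m × Fin m → Set
DisjointPairs p q = ∀ {v} → p ∋ v → ¬ q ∋ v

listPairing : ∀ {m} (ps : List (Fin m × Fin m)) → All (λ (x , y) → x ≢ y) ps →
  AllPairs DisjointPairs ps → Pairing m
listPairing {m} ps distinct disjoint = record
  { Paired = Mate
  ; symmetric = [ inj₂ , inj₁ ]′
  ; functional = fun
  ; irreflexive = [ irr , irr ]′
  ; partner? = λ x → any? λ y → ((x , y) ∈ₚ? ps) ⊎-dec ((y , x) ∈ₚ? ps)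
  }
  where
  open DecMembership (≡-dec (_≟_ {m}) (_≟_ {m})) using () renaming (_∈?_ to _∈ₚ?_)
  Mate : Fin m → Fin m → Set
  Mate x y = (x , y) ∈ ps ⊎ (y , x) ∈ ps
  irr : ∀ {x} → ¬ (x , x) ∈ ps
  irr x∈ = All.lookup distinct x∈ refl
  same : ∀ {p q v} → p ∈ ps → q ∈ ps → p ∋ v → q ∋ v → p ≡ q
  same p∈ q∈ pv qv with ∈-AllPairs₂ disjoint p∈ q∈
  ... | inj₁ p≡q = p≡q
  ... | inj₂ (inj₁ disj) = contradiction qv (disj pv)
  ... | inj₂ (inj₂ disj) = contradiction pv (disj qv)
  fun : ∀ {x y y′} → Mate x y → Mate x y′ → y ≡ y′
  fun (inj₁ p) (inj₁ q) = cong proj₂ (same p q (inj₁ refl) (inj₁ refl))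
  fun (inj₂ p) (inj₂ q) = cong proj₁ (same p q (inj₂ refl) (inj₂ refl))
  fun (inj₁ p) (inj₂ q) with refl ← same p q (inj₁ refl) (inj₂ refl) = refl
  fun (inj₂ p) (inj₁ q) with refl ← same p q (inj₂ refl) (inj₁ refl) = refl

-- Links

module _ {m : ℕ} where

  initial-source : (s t : Fin m) → initial s t s ≡ short
  initial-source s t rewrite dec-true (s ≟ s) refl = refl

  initial-target : (s t : Fin m) → initial s t t ≡ short
  initial-target s t rewrite dec-true (t ≟ t) refl with does (t ≟ s)
  ... | true = refl
  ... | false = refl

  initial-free : {s t v : Fin m} → v ≢ s → v ≢ t → initial s t v ≡ free
  initial-free {s} {t} {v} v≢s v≢t
    rewrite dec-false (v ≟ s) v≢s | dec-false (v ≟ t) v≢t = refl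

  initial-not-cut : (s t v : Fin m) → initial s t v ≢ cut
  initial-not-cut s t v with does (v ≟ s) ∨ does (v ≟ t)
  ... | true = λ ()
  ... | false = λ ()

  initial-swap : (s t v : Fin m) → initial s t v ≡ initial t s v
  initial-swap s t v rewrite ∨-comm (does (v ≟ s)) (does (v ≟ t)) = refl

  HitBy : State m → Fin m × Fin m → Set
  HitBy ρ (x , y) = ρ x ≡ short ⊎ ρ y ≡ short

  Conn-cong : ∀ {adj : Fin m → Fin m → Bool} {σ τ : State m} {x y} → (∀ v → σ v ≡ τ v) →
    Conn adj σ x y → Conn adj τ x y
  Conn-cong σ≗τ here = here
  Conn-cong σ≗τ (step c e w-short) =
    step (Conn-cong σ≗τ c) e (trans (≡-sym (σ≗τ _)) w-short)

  Conn-short : ∀ {adj : Fin m → Fin m → Bool} {σ : State m} {x y} → Conn adj σ x y →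
    y ≡ x ⊎ σ y ≡ short
  Conn-short here = inj₁ refl
  Conn-short (step _ _ y-short) = inj₂ y-short

  Conn-prepend : ∀ {adj : Fin m → Fin m → Bool} {σ : State m} {x y z} →
    adj x y ≡ true → σ y ≡ short → Conn adj σ y z → Conn adj σ x z
  Conn-prepend e y-short here = step here e y-short
  Conn-prepend e y-short (step c e′ w-short) = step (Conn-prepend e y-short c) e′ w-short

  -- `Conn` leaves the label of its starting vertex open, but the reversed path enters that vertex
  -- by a step, hence the assumption that it is short.
  Conn-reverse : ∀ {adj : Fin m → Fin m → Bool} {σ : State m} {x y} →
    (∀ u v → adj u v ≡ adj v u) → σ x ≡ short → Conn adj σ x y → Conn adj σ y x
  Conn-reverse adj-sym x-short here = here
  Conn-reverse adj-sym x-short (step c e _) =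
    Conn-prepend (trans (adj-sym _ _) e)
      ([ (λ v≡x → trans (cong _ v≡x) x-short) , id ]′ (Conn-short c))
      (Conn-reverse adj-sym x-short c)

  -- Short copies the strategy move by move, and only the final connection is translated. Positions
  -- are functions, so they are compared pointwise.
  ShortWins-transfer : ∀ {adj adj′ : Fin m → Fin m → Bool} {s t s′ t′} →
    (∀ ρ → ρ s ≡ short → Conn adj ρ s t → Conn adj′ ρ s′ t′) →
    ∀ {σ τ p} → σ s ≡ short → (∀ v → σ v ≡ τ v) →
    ShortWins adj s t σ p → ShortWins adj′ s′ t′ τ p
  ShortWins-transfer f s-short σ≗τ (finished full c) =
    finished (λ v v-free → full v (trans (σ≗τ v) v-free)) (Conn-cong σ≗τ (f _ s-short c))
  ShortWins-transfer f {σ} s-short σ≗τ (shortMove v v-free win) =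
    shortMove v (trans (≡-sym (σ≗τ v)) v-free)
      (ShortWins-transfer f
        (trans (update-keeps σ v-free (λ s-free → case trans (≡-sym s-short) s-free of λ ())) s-short)
        (update-cong v short σ≗τ) win)
  ShortWins-transfer f {σ} s-short σ≗τ (cutMove (v , v-free) win) =
    cutMove (v , trans (≡-sym (σ≗τ v)) v-free) λ u u-free →
      let u-free′ = trans (σ≗τ u) u-free in
      ShortWins-transfer f
        (trans (update-keeps σ u-free′ (λ s-free → case trans (≡-sym s-short) s-free of λ ())) s-short)
        (update-cong u cut σ≗τ) (win u u-free′)

  first-transfer : ∀ {adj adj′ : Fin m → Fin m → Bool} {s t} →
    (∀ ρ → Conn adj ρ s t → Conn adj′ ρ s t) →
    ShortWinsFirst adj s t → ShortWinsFirst adj′ s t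
  first-transfer {s = s} {t} f =
    ShortWins-transfer (λ ρ _ → f ρ) (initial-source s t) (λ _ → refl)

  first-swap : ∀ {adj : Fin m → Fin m → Bool} {s t} → (∀ u v → adj u v ≡ adj v u) →
    ShortWinsFirst adj s t → ShortWinsFirst adj t s
  first-swap {s = s} {t} adj-sym =
    ShortWins-transfer (λ ρ → Conn-reverse adj-sym) (initial-source s t) (initial-swap s t)

  -- Reduces a win as first player to connectedness of those positions in which `t`, `v` and a
  -- member of each listed pair are Short's.
  first-move-then-pairing : ∀ {adj : Fin m → Fin m → Bool} {s t} v (ps : List (Fin m × Fin m)) →
    v ≢ s → v ≢ t → All (λ (x , y) → x ≢ y) ps → AllPairs DisjointPairs ps →
    (∀ {ρ} → ρ t ≡ short → ρ v ≡ short → All (HitBy ρ) ps → Conn adj ρ s t) →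
    ShortWinsFirst adj s t
  first-move-then-pairing {adj} {s} {t} v ps v≢s v≢t distinct disjoint connected =
    shortMove v (initial-free v≢s v≢t)
      (short-pairing-strategy (listPairing ps distinct disjoint)
        (λ ρ σ⊑ρ hit → connected
          (keeps σ⊑ρ (trans (update-other (initial s t) short (v≢t ∘ ≡-sym)) (initial-target s t)))
          (keeps σ⊑ρ (update-same (initial s t) v short))
          (All.tabulate (λ p∈ → hit (inj₁ p∈))))
        -- After Short's first move nothing has been cut, so the invariant holds vacuously.
        (λ x _ _ x-cut → contradiction x-cut (not-cut x (x ≟ v))))
    where
    σ = initial s t [ v ↦ short ]
    keeps : ∀ {ρ u} → σ ⊑ ρ → σ u ≡ short → ρ u ≡ short
    keeps {u = u} σ⊑ρ u-short =
      trans (σ⊑ρ u (λ u-free → case trans (≡-sym u-short) u-free of λ ())) u-short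
    not-cut : ∀ x → Dec (x ≡ v) → σ x ≢ cut
    not-cut x (yes refl) x-cut = case trans (≡-sym (update-same (initial s t) v short)) x-cut of λ ()
    not-cut x (no x≢v) x-cut =
      initial-not-cut s t x (trans (≡-sym (update-other (initial s t) short x≢v)) x-cut)

  module _ (adj : Fin m → Fin m → Bool) where

    deleteEdge-keeps : ∀ {a b u v} → adj u v ≡ true → ¬ (u ≡ a × v ≡ b) → ¬ (u ≡ b × v ≡ a) →
      deleteEdge adj a b u v ≡ true
    deleteEdge-keeps {a} {b} {u} {v} e ≢ab ≢ba with u ≟ a | v ≟ b | u ≟ b | v ≟ a
    ... | yes p | yes q | _ | _ = contradiction (p , q) ≢ab
    ... | _ | _ | yes p | yes q = contradiction (p , q) ≢ba
    ... | yes _ | no _ | yes _ | no _ = e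
    ... | yes _ | no _ | no _ | _ = e
    ... | no _ | _ | yes _ | no _ = e
    ... | no _ | _ | no _ | _ = e

    deleteEdge-sym : (∀ u v → adj u v ≡ adj v u) →
      ∀ a b u v → deleteEdge adj a b u v ≡ deleteEdge adj a b v u
    deleteEdge-sym adj-sym a b u v
      rewrite 𝔹ₚ.∧-comm (does (v ≟ a)) (does (u ≟ b))
            | 𝔹ₚ.∧-comm (does (v ≟ b)) (does (u ≟ a))
            | ∨-comm (does (u ≟ b) ∧ does (v ≟ a)) (does (u ≟ a) ∧ does (v ≟ b))
            | adj-sym u v = refl

¬true⇒false : ∀ {x} → ¬ x ≡ true → x ≡ false
¬true⇒false {false} _ = refl
¬true⇒false {true} ¬true = contradiction refl ¬true

<-∸2 : ∀ {k m} → k < m ∸ 2 → 2 + k < m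
<-∸2 {m = suc (suc m)} k<m = s≤s (s≤s k<m)

-- Consequences of minimality for single edges

module Link (G : Graph) (s t : Fin (n G)) (s≢t : s ≢ t)
  (short-first : ShortWinsFirst (adj G) s t)
  (minimal : ∀ a b → adj G a b ≡ true → ¬ ShortWinsFirst (deleteEdge (adj G) a b) s t) where

  V : Set
  V = Fin (n G)

  _~_ : V → V → Set
  u ~ v = adj G u v ≡ true

  _~?_ : ∀ u v → Dec (u ~ v)
  u ~? v = adj G u v 𝔹ₚ.≟ true

  ~-sym : ∀ {u v} → u ~ v → v ~ u
  ~-sym {u} {v} = trans (sym G v u)

  ~-irrefl : ∀ {v} → ¬ v ~ v
  ~-irrefl {v} v~v = case trans (≡-sym v~v) (irrefl G v) of λ ()

  ~⇒≢ : ∀ {u v} → u ~ v → u ≢ v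
  ~⇒≢ u~v refl = ~-irrefl u~v

  separated : (P : V → Set) → ∀ {u v} → P u → ¬ P v → u ≢ v
  separated P Pu ¬Pv refl = ¬Pv Pu

  record Centre (v : V) : Set where
    constructor centre
    field
      ≢s  : v ≢ s
      ≢t  : v ≢ t
      ¬s~ : ¬ s ~ v
      ¬~t : ¬ v ~ t
  open Centre

  Centre⇒isCentre : ∀ {v} → Centre v → isCentre G s t v ≡ true
  Centre⇒isCentre {v} (centre v≢s v≢t ¬s~v ¬v~t)
    rewrite dec-false (v ≟ s) v≢s | dec-false (v ≟ t) v≢t
          | ¬true⇒false ¬s~v | ¬true⇒false (¬v~t ∘ ~-sym) = refl

  centre? : ∀ v → v ≡ s ⊎ v ≡ t ⊎ s ~ v ⊎ v ~ t ⊎ Centre v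
  centre? v with v ≟ s | v ≟ t | s ~? v | v ~? t
  ... | yes v≡s | _ | _ | _ = inj₁ v≡s
  ... | no _ | yes v≡t | _ | _ = inj₂ (inj₁ v≡t)
  ... | no _ | no _ | yes s~v | _ = inj₂ (inj₂ (inj₁ s~v))
  ... | no _ | no _ | no _ | yes v~t = inj₂ (inj₂ (inj₂ (inj₁ v~t)))
  ... | no v≢s | no v≢t | no ¬s~v | no ¬v~t = inj₂ (inj₂ (inj₂ (inj₂ (centre v≢s v≢t ¬s~v ¬v~t))))

  -- If every path could avoid the edge, Short's strategy would survive its deletion.
  edge-needed : ∀ {a b} → a ~ b → ¬ (∀ ρ → Conn (adj G) ρ s t → Conn (deleteEdge (adj G) a b) ρ s t)
  edge-needed a~b f = minimal _ _ a~b (first-transfer f short-first)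

  keep : ∀ {a b u v} → u ~ v → ¬ (u ≡ a × v ≡ b) → ¬ (u ≡ b × v ≡ a) →
    deleteEdge (adj G) a b u v ≡ true
  keep = deleteEdge-keeps (adj G)

  -- The edge from `s` to `t` would connect every position, even with the edge from `s` to `v`
  -- deleted; `v` also supplies Short's first move.
  s≁t : ∀ {v} → v ≢ s → v ≢ t → s ~ v → ¬ s ~ t
  s≁t v≢s v≢t s~v s~t = minimal _ _ s~v
    (first-move-then-pairing _ [] v≢s v≢t [] []
      λ t-short _ _ → step here (keep s~t (v≢t ∘ ≡-sym ∘ proj₂) (v≢s ∘ ≡-sym ∘ proj₁)) t-short)

  -- An edge joining two neighbours of s can be bypassed through s.
  source-border-independent : ∀ {u v} → s ~ u → s ~ v → ¬ u ~ v
  source-border-independent {u} {v} s~u s~v u~v = edge-needed u~v (λ ρ → bypass)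
    where
    bypass : ∀ {ρ w} → Conn (adj G) ρ s w → Conn (deleteEdge (adj G) u v) ρ s w
    bypass here = here
    bypass (step {x} {y} c x~y y-short) with (x ≟ u) ×-dec (y ≟ v) | (x ≟ v) ×-dec (y ≟ u)
    ... | yes (refl , refl) | _ = step here (keep s~v (~⇒≢ s~u ∘ proj₁) (~⇒≢ s~v ∘ proj₁)) y-short
    ... | no _ | yes (refl , refl) =
      step here (keep s~u (~⇒≢ s~u ∘ proj₁) (~⇒≢ s~v ∘ proj₁)) y-short
    ... | no ≢uv | no ≢vu = step (bypass c) (keep x~y ≢uv ≢vu) y-short

  -- Small wins and isolated vertices

  Isolated : List V → Set
  Isolated L = ∀ {u x} → u ∉ L → ¬ u ~ x

  -- `connected` holds for every `adj′` that retains the edges inside `L`, thus also after deleting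
  -- an edge at a vertex outside `L`. Minimality then forbids such an edge.
  isolated-outside : ∀ L v ps → v ≢ s → v ≢ t →
    All (λ (x , y) → x ≢ y) ps → AllPairs DisjointPairs ps →
    (∀ {adj′ ρ} → (∀ {x y} → x ∈ L → y ∈ L → x ~ y → adj′ x y ≡ true) →
      ρ t ≡ short → ρ v ≡ short → All (HitBy ρ) ps → Conn adj′ ρ s t) →
    Isolated L
  isolated-outside L v ps v≢s v≢t distinct disjoint connected {u} u∉L u~x =
    minimal _ _ u~x (first-move-then-pairing v ps v≢s v≢t distinct disjoint
      (connected λ x∈L y∈L x~y → keep x~y
        (λ { (refl , _) → u∉L x∈L }) (λ { (_ , refl) → u∉L y∈L })))

  pattern at0 = here refl
  pattern at1 = there at0
  pattern at2 = there at1
  pattern at3 = there at2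
  pattern at4 = there at3
  pattern at5 = there at4
  pattern at6 = there at5

  through-one : ∀ {v} → s ~ v → v ~ t → Isolated (s ∷ t ∷ v ∷ [])
  through-one {v} s~v v~t = isolated-outside (s ∷ t ∷ v ∷ []) v []
    (~⇒≢ s~v ∘ ≡-sym) (~⇒≢ v~t) [] []
    λ keeps t-short v-short _ →
      step (step here (keeps at0 at2 s~v) v-short) (keeps at2 at1 v~t) t-short

  -- Short claims `v` and pairs `x` with `y`; either of them completes a path.
  fork-to-target : ∀ {v x y} → v ≢ t → s ~ v → v ~ x → v ~ y → x ~ t → y ~ t → x ≢ y →
    Isolated (s ∷ t ∷ v ∷ x ∷ y ∷ [])
  fork-to-target {v} {x} {y} v≢t s~v v~x v~y x~t y~t x≢y =
    isolated-outside _ v ((x , y) ∷ []) (~⇒≢ s~v ∘ ≡-sym) v≢t (x≢y ∷ []) ([] ∷ [])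
    λ { keeps t-short v-short (inj₁ x-short ∷ []) →
          step (step (step here (keeps at0 at2 s~v) v-short) (keeps at2 at3 v~x) x-short)
            (keeps at3 at1 x~t) t-short
      ; keeps t-short v-short (inj₂ y-short ∷ []) →
          step (step (step here (keeps at0 at2 s~v) v-short) (keeps at2 at4 v~y) y-short)
            (keeps at4 at1 y~t) t-short }

  fork-to-source : ∀ {v x y} → v ≢ s → s ~ x → s ~ y → x ~ v → y ~ v → v ~ t → x ≢ y →
    Isolated (s ∷ t ∷ v ∷ x ∷ y ∷ [])
  fork-to-source {v} {x} {y} v≢s s~x s~y x~v y~v v~t x≢y =
    isolated-outside _ v ((x , y) ∷ []) v≢s (~⇒≢ v~t) (x≢y ∷ []) ([] ∷ [])
    λ { keeps t-short v-short (inj₁ x-short ∷ []) →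
          step (step (step here (keeps at0 at3 s~x) x-short) (keeps at3 at2 x~v) v-short)
            (keeps at2 at1 v~t) t-short
      ; keeps t-short v-short (inj₂ y-short ∷ []) →
          step (step (step here (keeps at0 at4 s~y) y-short) (keeps at4 at2 y~v) v-short)
            (keeps at2 at1 v~t) t-short }

  -- Degree bounds by comparison with the centre

  Bound : V → Set
  Bound b = (3 < weight G → degree G b ≤ centreSize G s t + 2) ×
            (5 < weight G → degree G b ≤ centreSize G s t + 1)

  -- `M` lists central vertices missed by `b`, and `N` covers its neighbours that are not central:
  -- the degree is at most the centre size plus the length of `N` minus that of `M`.
  degree-bound : ∀ {b} (M N : List V) k → Unique M → length N ≡ k + length M →
    (∀ {u} → u ∈ M → Centre u × ¬ b ~ u) → (∀ u → b ~ u → Centre u ⊎ u ∈ N) →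
    degree G b ≤ centreSize G s t + k
  degree-bound {b} M N k uniqM |N| M⊆ N⊇ = ℕₚ.+-cancelʳ-≤ (length M) _ _
    (subst (degree G b + length M ≤_)
      (trans (cong (centreSize G s t +_) |N|) (≡-sym (ℕₚ.+-assoc (centreSize G s t) k _)))
      (count-≤ (adj G b) (isCentre G s t) M N uniqM
        (λ u∈ → Centre⇒isCentre (proj₁ (M⊆ u∈)) , ¬true⇒false (proj₂ (M⊆ u∈)))
        (λ u b~u → [ inj₁ ∘ Centre⇒isCentre , inj₂ ]′ (N⊇ u b~u))))

  isolated⇒Centre : ∀ {L u} → s ∈ L → t ∈ L → Isolated L → u ∉ L → Centre u
  isolated⇒Centre s∈L t∈L isolated u∉L = centre
    (λ { refl → u∉L s∈L }) (λ { refl → u∉L t∈L }) (isolated u∉L ∘ ~-sym) (isolated u∉L)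

  -- Vertices outside `L` are central and not adjacent to `b`. At most five vertices lie in `L`, so
  -- one is outside if the weight exceeds 3 and two are if it exceeds 5, against at most three
  -- neighbours.
  few-neighbours-bound : ∀ {b} L (N : List V) → length L ≤ 5 → length N ≡ 3 →
    s ∈ L → t ∈ L → Isolated L → (∀ u → b ~ u → u ∈ N) → Bound b
  few-neighbours-bound {b} L N |L| |N| s∈L t∈L isolated N⊇ = weak , strong
    where
    outside : ∀ {u} → u ∉ L → Centre u × ¬ b ~ u
    outside u∉L = isolated⇒Centre s∈L t∈L isolated u∉L , isolated u∉L ∘ ~-sym
    weak : 3 < weight G → degree G b ≤ centreSize G s t + 2
    weak 3<w with fresh L (ℕₚ.≤-<-trans |L| (<-∸2 3<w))
    ... | u , u∉L = degree-bound (u ∷ []) N 2 ([] ∷ []) |N|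
      (λ { (here refl) → outside u∉L }) (λ v → inj₂ ∘ N⊇ v)
    strong : 5 < weight G → degree G b ≤ centreSize G s t + 1
    strong 5<w with fresh L (ℕₚ.≤-<-trans |L| (≤-trans (ℕₚ.m≤n+m 6 2) (<-∸2 5<w)))
    ... | u , u∉L with fresh (u ∷ L) (ℕₚ.≤-<-trans (s≤s |L|) (≤-trans (ℕₚ.m≤n+m 7 1) (<-∸2 5<w)))
    ...   | v , v∉ = degree-bound (v ∷ u ∷ []) N 1 (((v∉ ∘ here) ∷ []) ∷ [] ∷ []) |N|
      (λ { (here refl) → outside (v∉ ∘ there) ; (there (here refl)) → outside u∉L })
      (λ v → inj₂ ∘ N⊇ v)

  -- A border vertex adjacent to `c` and to the whole centre

  module Dominating {b c : V} (s~b : s ~ b) (¬b~t : ¬ b ~ t) (b≢t : b ≢ t)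
    (b~c : b ~ c) (c~t : c ~ t) (only-c : ∀ {x} → b ~ x → x ~ t → x ≡ c)
    (dominates : ∀ {z} → Centre z → b ~ z) (large : 7 < n G) where

    spanning : ∀ L → length L ≤ 7 → s ∈ L → t ∈ L → ¬ Isolated L
    spanning L |L| s∈L t∈L isolated with fresh L (ℕₚ.≤-<-trans |L| large)
    ... | u , u∉L = isolated u∉L (~-sym (dominates (isolated⇒Centre s∈L t∈L isolated u∉L)))

    b≢s : b ≢ s
    b≢s = ~⇒≢ s~b ∘ ≡-sym

    c≢t : c ≢ t
    c≢t = ~⇒≢ c~t

    target-≢ : ∀ {u v} → u ~ t → ¬ v ~ t → u ≢ v
    target-≢ = separated (_~ t)

    borders-disjoint : ∀ {v} → s ~ v → ¬ v ~ t
    borders-disjoint s~v v~t = spanning _ (ℕₚ.m≤m+n 3 4) at0 at1 (through-one s~v v~t)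

    c≢s : c ≢ s
    c≢s refl = s≁t b≢s b≢t s~b c~t

    -- Otherwise Short claims `c`, pairs `v` with `b` and wins inside five vertices.
    source-neighbour-of-c : ∀ {v} → s ~ v → v ~ c → v ≡ b
    source-neighbour-of-c {v} s~v v~c = decidable-stable (v ≟ b) λ v≢b →
      spanning _ (ℕₚ.m≤m+n 5 2) at0 at1 (fork-to-source c≢s s~v s~b v~c b~c c~t v≢b)

    source-fork : ∀ {v x y} → v ≢ t → s ~ v → v ~ x → v ~ y → x ~ t → y ~ t → x ≡ y
    source-fork {v} {x} {y} v≢t s~v v~x v~y x~t y~t = decidable-stable (x ≟ y) λ x≢y →
      spanning _ (ℕₚ.m≤m+n 5 2) at0 at1 (fork-to-target v≢t s~v v~x v~y x~t y~t x≢y)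

    -- Otherwise Short claims `b` and pairs `c` with `z` and `x` with `y`. Holding `c` he wins
    -- through `b` and `c`; holding `z` he goes on from `b` through `z` to whichever of `x` and `y`
    -- he has.
    centre-fork : ∀ {z x y} → Centre z → z ~ x → z ~ y → x ~ t → y ~ t → x ≢ c → y ≢ c → x ≡ y
    centre-fork {z} {x} {y} Cz z~x z~y x~t y~t x≢c y≢c = decidable-stable (x ≟ y) λ x≢y →
      spanning (s ∷ t ∷ b ∷ c ∷ z ∷ x ∷ y ∷ []) ≤-refl at0 at1
        (isolated-outside _ b ((c , z) ∷ (x , y) ∷ []) b≢s b≢t
          (target-≢ c~t (¬~t Cz) ∷ x≢y ∷ [])
          (((λ { (inj₁ refl) (inj₁ c≡x) → x≢c (≡-sym c≡x)
               ; (inj₁ refl) (inj₂ c≡y) → y≢c (≡-sym c≡y)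
               ; (inj₂ refl) (inj₁ z≡x) → target-≢ x~t (¬~t Cz) (≡-sym z≡x)
               ; (inj₂ refl) (inj₂ z≡y) → target-≢ y~t (¬~t Cz) (≡-sym z≡y) }) ∷ []) ∷ [] ∷ [])
          λ { keeps t-short b-short (inj₁ c-short ∷ _) →
                step (step (step here (keeps at0 at2 s~b) b-short) (keeps at2 at3 b~c) c-short)
                  (keeps at3 at1 c~t) t-short
            ; keeps t-short b-short (inj₂ z-short ∷ inj₁ x-short ∷ []) →
                step (step (step (step here (keeps at0 at2 s~b) b-short)
                  (keeps at2 at4 (dominates Cz)) z-short) (keeps at4 at5 z~x) x-short)
                  (keeps at5 at1 x~t) t-short
            ; keeps t-short b-short (inj₂ z-short ∷ inj₂ y-short ∷ []) →
                step (step (step (step here (keeps at0 at2 s~b) b-short)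
                  (keeps at2 at4 (dominates Cz)) z-short) (keeps at4 at6 z~y) y-short)
                  (keeps at6 at1 y~t) t-short })

    data Near (z : V) : Set where
      border  : s ~ z → Near z
      central : Centre z → Near z

    near-reached : ∀ {adj′ : V → V → Bool} {ρ z} → Near z → (s ~ z → adj′ s z ≡ true) →
      adj′ s b ≡ true → (b ~ z → adj′ b z ≡ true) → ρ b ≡ short → ρ z ≡ short → Conn adj′ ρ s z
    near-reached (border s~z) sz sb bz b-short z-short = step here (sz s~z) z-short
    near-reached (central Cz) sz sb bz b-short z-short =
      step (step here sb b-short) (bz (dominates Cz)) z-short

    near-≁t : ∀ {z} → Near z → ¬ z ~ t
    near-≁t (border s~z) = borders-disjoint s~z
    near-≁t (central Cz) = ¬~t Cz

    -- Otherwise Short claims `b` and pairs `c` with `y` and `z` with `z′`. If he gets `y` instead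
    -- of `c`, he enters it from `z` or `z′`, reached from `s` directly or through `b`.
    target-fork : ∀ {y z z′} → Near z → Near z′ → z ~ y → z′ ~ y → y ~ t → y ≢ c → z ≡ z′
    target-fork {y} {z} {z′} Nz Nz′ z~y z′~y y~t y≢c = decidable-stable (z ≟ z′) λ z≢z′ →
      spanning (s ∷ t ∷ b ∷ c ∷ y ∷ z ∷ z′ ∷ []) ≤-refl at0 at1
        (isolated-outside _ b ((c , y) ∷ (z , z′) ∷ []) b≢s b≢t
          (y≢c ∘ ≡-sym ∷ z≢z′ ∷ [])
          (((λ { (inj₁ refl) (inj₁ c≡z) → target-≢ c~t (near-≁t Nz) c≡z
               ; (inj₁ refl) (inj₂ c≡z′) → target-≢ c~t (near-≁t Nz′) c≡z′
               ; (inj₂ refl) (inj₁ y≡z) → target-≢ y~t (near-≁t Nz) y≡z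
               ; (inj₂ refl) (inj₂ y≡z′) → target-≢ y~t (near-≁t Nz′) y≡z′ }) ∷ []) ∷ [] ∷ [])
          λ { keeps t-short b-short (inj₁ c-short ∷ _) →
                step (step (step here (keeps at0 at2 s~b) b-short) (keeps at2 at3 b~c) c-short)
                  (keeps at3 at1 c~t) t-short
            ; keeps t-short b-short (inj₂ y-short ∷ inj₁ z-short ∷ []) →
                step (step
                  (near-reached Nz (keeps at0 at5) (keeps at0 at2 s~b) (keeps at2 at5) b-short z-short)
                  (keeps at5 at4 z~y) y-short) (keeps at4 at1 y~t) t-short
            ; keeps t-short b-short (inj₂ y-short ∷ inj₂ z′-short ∷ []) →
                step (step
                  (near-reached Nz′ (keeps at0 at6) (keeps at0 at2 s~b) (keeps at2 at6) b-short z′-short)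
                  (keeps at6 at4 z′~y) y-short) (keeps at4 at1 y~t) t-short })

    -- If the only neighbour of t adjacent to z were c, then any path using the edge b z
    -- could be rerouted through b or s, so that edge would not be needed.
    private-exit : ∀ {z} → Centre z → ∃ λ y → z ~ y × y ~ t × y ≢ c
    private-exit {z} Cz with any? (λ y → (z ~? y) ×-dec ((y ~? t) ×-dec ¬? (y ≟ c)))
    ... | yes exit = exit
    ... | no none = ⊥-elim (edge-needed (dominates Cz) λ ρ conn →
            [ id , (λ (t≡z , _) → contradiction (≡-sym t≡z) (≢t Cz)) ]′ (reroute conn))
      where
      adj′ : V → V → Bool
      adj′ = deleteEdge (adj G) b z
      b≢z : b ≢ z
      b≢z = ~⇒≢ (dominates Cz)
      z≢s : z ≢ s
      z≢s = ≢s Cz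
      sb : adj′ s b ≡ true
      sb = keep s~b (b≢s ∘ ≡-sym ∘ proj₁) (z≢s ∘ ≡-sym ∘ proj₁)
      from-s : ∀ {w} → s ~ w → adj′ s w ≡ true
      from-s s~w = keep s~w (b≢s ∘ ≡-sym ∘ proj₁) (z≢s ∘ ≡-sym ∘ proj₁)
      from-b : ∀ {w} → w ≢ z → b ~ w → adj′ b w ≡ true
      from-b w≢z b~w = keep b~w (w≢z ∘ proj₂) (b≢z ∘ proj₁)
      -- Only `z` itself may become unreachable, and then Short holds `b`. The vertex after `z` is
      -- regained from `s`, or through `b` if it is central or `c`.
      reroute : ∀ {ρ w} → Conn (adj G) ρ s w →
        Conn adj′ ρ s w ⊎ (w ≡ z × ρ b ≡ short)
      reroute here = inj₁ here
      reroute (step {x} {w} conn x~w w-short) with reroute conn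
      ... | inj₁ conn′ with (x ≟ b) ×-dec (w ≟ z) | (x ≟ z) ×-dec (w ≟ b)
      ...   | yes (refl , refl) | _ =
        inj₂ (refl , [ (λ b≡s → contradiction b≡s b≢s) , id ]′ (Conn-short conn))
      ...   | no _ | yes (refl , refl) = inj₁ (step here sb w-short)
      ...   | no ≢bz | no ≢zb = inj₁ (step conn′ (keep x~w ≢bz ≢zb) w-short)
      reroute (step {x} {w} conn x~w w-short) | inj₂ (refl , b-short) with centre? w
      ... | inj₁ refl = inj₁ here
      ... | inj₂ (inj₁ refl) = contradiction x~w (¬~t Cz)
      ... | inj₂ (inj₂ (inj₁ s~w)) = inj₁ (step here (from-s s~w) w-short)
      ... | inj₂ (inj₂ (inj₂ (inj₂ Cw))) =
        inj₁ (step (step here sb b-short) (from-b (~⇒≢ x~w ∘ ≡-sym) (dominates Cw)) w-short)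
      ... | inj₂ (inj₂ (inj₂ (inj₁ w~t))) with w ≟ c
      ...   | yes refl =
        inj₁ (step (step here sb b-short) (from-b (~⇒≢ x~w ∘ ≡-sym) b~c) w-short)
      ...   | no w≢c = contradiction (w , x~w , w~t , w≢c) none

    -- Made total so that pairs can be formed without a proof of centrality; the default `z` does
    -- not occur for central `z`, by `private-exit`.
    exit : V → V
    exit z with any? (λ y → (z ~? y) ×-dec ((y ~? t) ×-dec ¬? (y ≟ c)))
    ... | yes (y , _) = y
    ... | no _ = z

    exit-spec : ∀ {z} → Centre z → z ~ exit z × exit z ~ t × exit z ≢ c
    exit-spec {z} Cz with any? (λ y → (z ~? y) ×-dec ((y ~? t) ×-dec ¬? (y ≟ c)))
    ... | yes (_ , spec) = spec
    ... | no none = contradiction (private-exit Cz) none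

    exit-injective : ∀ {z z′} → Centre z → Centre z′ → exit z ≡ exit z′ → z ≡ z′
    exit-injective {z} {z′} Cz Cz′ same with exit-spec Cz | exit-spec Cz′
    ... | z~y , y~t , y≢c | z′~y , _ =
      target-fork (central Cz) (central Cz′) z~y (subst (z′ ~_) (≡-sym same) z′~y) y~t y≢c

    -- Walk z zs: a walk s, b′, …, z whose inner vertices avoid b and whose central part,
    -- read backwards, is zs.
    data Walk : V → List V → Set where
      enter  : ∀ {b′ z} → b′ ≢ b → s ~ b′ → b′ ~ z → Centre z → Walk z (z ∷ [])
      extend : ∀ {w z ws} → Walk w ws → w ~ z → Centre z → Walk z (z ∷ ws)

    shorten : ∀ {z ws x} → Walk z ws → Unique ws → x ∈ ws → ∃ λ xs → Walk x xs × Unique xs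
    shorten W@(enter _ _ _ _) uniq (here refl) = _ , W , uniq
    shorten W@(extend _ _ _) uniq (here refl) = _ , W , uniq
    shorten (extend W _ _) (_ ∷ uniq) (there x∈) = shorten W uniq x∈

    Linked : V → Set
    Linked z = ∃ λ ws → Walk z ws × Unique ws

    -- A return to a vertex already visited is cut off by `shorten`. Walks are kept free of
    -- repetition so that their exit pairs are disjoint.
    link-extend : ∀ {w z} → Linked w → w ~ z → Centre z → Linked z
    link-extend {z = z} (ws , W , uniq) w~z Cz with z ∈? ws
    ... | yes z∈ws = shorten W uniq z∈ws
    ... | no z∉ws =
      _ , extend W w~z Cz , All.tabulate (λ x∈ z≡x → z∉ws (subst (_∈ ws) (≡-sym z≡x) x∈)) ∷ uniq

    walk-central : ∀ {z ws} → Walk z ws → All Centre ws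
    walk-central (enter _ _ _ Cz) = Cz ∷ []
    walk-central (extend W _ Cz) = Cz ∷ walk-central W

    walk-end-central : ∀ {z ws} → Walk z ws → Centre z
    walk-end-central (enter _ _ _ Cz) = Cz
    walk-end-central (extend _ _ Cz) = Cz

    entrance : ∀ {z ws} → Walk z ws → V
    entrance (enter {b′} _ _ _ _) = b′
    entrance (extend W _ _) = entrance W

    entrance-spec : ∀ {z ws} (W : Walk z ws) → entrance W ≢ b × s ~ entrance W
    entrance-spec (enter b′≢b s~b′ _ _) = b′≢b , s~b′
    entrance-spec (extend W _ _) = entrance-spec W

    first-central : ∀ {z ws} → Walk z ws → V
    first-central (enter {z = z} _ _ _ _) = z
    first-central (extend W _ _) = first-central W

    first-central-spec : ∀ {z ws} (W : Walk z ws) → Centre (first-central W)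
    first-central-spec (enter _ _ _ Cz) = Cz
    first-central-spec (extend W _ _) = first-central-spec W

    -- Each z is held by Short; its exit is paired with the next vertex of the walk.
    exitPairs : V → List V → List (V × V)
    exitPairs next [] = []
    exitPairs next (z ∷ zs) = (exit z , next) ∷ exitPairs z zs

    exitPairs-∋ : ∀ {p v} next zs → p ∈ exitPairs next zs → p ∋ v →
      v ≡ next ⊎ v ∈ zs ⊎ ∃ λ w → w ∈ zs × v ≡ exit w
    exitPairs-∋ next (z ∷ zs) (here refl) (inj₁ v≡exit) = inj₂ (inj₂ (z , here refl , v≡exit))
    exitPairs-∋ next (z ∷ zs) (here refl) (inj₂ v≡next) = inj₁ v≡next
    exitPairs-∋ next (z ∷ zs) (there p∈) p∋v with exitPairs-∋ z zs p∈ p∋v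
    ... | inj₁ v≡z = inj₂ (inj₁ (here v≡z))
    ... | inj₂ (inj₁ v∈zs) = inj₂ (inj₁ (there v∈zs))
    ... | inj₂ (inj₂ (w , w∈zs , v≡exit)) = inj₂ (inj₂ (w , there w∈zs , v≡exit))

    exitPairs-head : ∀ {z ws x ρ} → Walk z ws → All (HitBy ρ) (exitPairs x ws) →
      HitBy ρ (exit z , x)
    exitPairs-head (enter _ _ _ _) (hit ∷ _) = hit
    exitPairs-head (extend _ _ _) (hit ∷ _) = hit

    Next : V → Set
    Next x = x ≡ c ⊎ Centre x

    exit≢next : ∀ {z x} → Centre z → Next x → exit z ≢ x
    exit≢next Cz (inj₁ refl) = proj₂ (proj₂ (exit-spec Cz))
    exit≢next Cz (inj₂ Cx) = target-≢ (proj₁ (proj₂ (exit-spec Cz))) (¬~t Cx)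

    exitPairs-distinct : ∀ {x zs} → Next x → All Centre zs →
      All (λ (u , v) → u ≢ v) (exitPairs x zs)
    exitPairs-distinct Nx [] = []
    exitPairs-distinct Nx (Cz ∷ Czs) = exit≢next Cz Nx ∷ exitPairs-distinct (inj₂ Cz) Czs

    -- Exits differ by `exit-injective` and walk vertices by uniqueness. An exit is adjacent to `t`
    -- and is not `c`, so it never equals a next vertex.
    exitPairs-disjoint : ∀ {x zs} → Next x → x ∉ zs → All Centre zs → Unique zs →
      AllPairs DisjointPairs (exitPairs x zs)
    exitPairs-disjoint Nx x∉ [] [] = []
    exitPairs-disjoint {x} {z ∷ zs} Nx x∉ (Cz ∷ Czs) uniq@(_ ∷ uniq′) =
      All.tabulate separate ∷ exitPairs-disjoint (inj₂ Cz) z∉zs Czs uniq′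
      where
      z∉zs : z ∉ zs
      z∉zs = Unique[x∷xs]⇒x∉xs uniq
      separate : ∀ {q} → q ∈ exitPairs z zs → DisjointPairs (exit z , x) q
      separate q∈ (inj₁ refl) q∋v with exitPairs-∋ z zs q∈ q∋v
      ... | inj₁ e = exit≢next Cz (inj₂ Cz) e
      ... | inj₂ (inj₁ v∈) = exit≢next Cz (inj₂ (All.lookup Czs v∈)) refl
      ... | inj₂ (inj₂ (w , w∈ , e)) =
        z∉zs (subst (_∈ zs) (≡-sym (exit-injective Cz (All.lookup Czs w∈) e)) w∈)
      separate q∈ (inj₂ refl) q∋v with exitPairs-∋ z zs q∈ q∋v
      ... | inj₁ x≡z = x∉ (here x≡z)
      ... | inj₂ (inj₁ x∈) = x∉ (there x∈)
      ... | inj₂ (inj₂ (w , w∈ , e)) = exit≢next (All.lookup Czs w∈) Nx (≡-sym e)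

    -- Such a walk reaching c would let Short win without the edge b c: he claims the first
    -- central vertex, pairs b with the entrance and every exit with the next vertex.
    linked-≁c : ∀ {z} → Linked z → ¬ z ~ c
    linked-≁c {z} (ws , W , uniq) z~c = minimal _ _ b~c
      (first-move-then-pairing z₁ ((b , b′) ∷ exitPairs c ws)
        (≢s (first-central-spec W)) (≢t (first-central-spec W))
        (b′≢b ∘ ≡-sym ∷ exitPairs-distinct (inj₁ refl) Cws)
        (All.tabulate separate ∷ exitPairs-disjoint (inj₁ refl) c∉ws Cws uniq)
        λ { t-short z₁-short (b-hit ∷ hits) → finish t-short z₁-short b-hit hits })
      where
      z₁ b′ : V
      z₁ = first-central W
      b′ = entrance W
      b′≢b : b′ ≢ b
      b′≢b = proj₁ (entrance-spec W)
      Cws : All Centre ws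
      Cws = walk-central W
      c∉ws : c ∉ ws
      c∉ws c∈ = ¬~t (All.lookup Cws c∈) c~t
      border-clear : ∀ {v q} → s ~ v → q ∈ exitPairs c ws → ¬ q ∋ v
      border-clear s~v q∈ q∋v with exitPairs-∋ c ws q∈ q∋v
      ... | inj₁ refl = borders-disjoint s~v c~t
      ... | inj₂ (inj₁ v∈) = ¬s~ (All.lookup Cws v∈) s~v
      ... | inj₂ (inj₂ (w , w∈ , refl)) =
        borders-disjoint s~v (proj₁ (proj₂ (exit-spec (All.lookup Cws w∈))))
      separate : ∀ {q} → q ∈ exitPairs c ws → DisjointPairs (b , b′) q
      separate q∈ (inj₁ refl) = border-clear s~b q∈
      separate q∈ (inj₂ refl) = border-clear (proj₂ (entrance-spec W)) q∈

      adj′ : V → V → Bool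
      adj′ = deleteEdge (adj G) b c
      clear-of-c : ∀ {u v} → u ≢ c → v ≢ c → u ~ v → adj′ u v ≡ true
      clear-of-c u≢c v≢c u~v = keep u~v (v≢c ∘ proj₂) (u≢c ∘ proj₁)
      clear-of-b : ∀ {u v} → u ≢ b → v ≢ b → u ~ v → adj′ u v ≡ true
      clear-of-b u≢b v≢b u~v = keep u~v (u≢b ∘ proj₁) (v≢b ∘ proj₂)
      border≢c : ∀ {v} → s ~ v → v ≢ c
      border≢c s~v = target-≢ c~t (borders-disjoint s~v) ∘ ≡-sym
      centre≢c : ∀ {v} → Centre v → v ≢ c
      centre≢c Cv = target-≢ c~t (¬~t Cv) ∘ ≡-sym
      centre≢b : ∀ {v} → Centre v → v ≢ b
      centre≢b Cv = separated (s ~_) s~b (¬s~ Cv) ∘ ≡-sym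
      target≢b : ∀ {v} → v ~ t → v ≢ b
      target≢b v~t = target-≢ v~t ¬b~t

      module _ {ρ : State (n G)} (t-short : ρ t ≡ short) where

        -- Holding the exit of `u`, Short finishes at `t` at once; otherwise he holds the next
        -- vertex and goes on.
        exit-or-next : ∀ {u v x} → Conn adj′ ρ s u → Centre u → HitBy ρ (exit u , v) →
          (ρ v ≡ short → Conn adj′ ρ s x) → Conn adj′ ρ s t ⊎ Conn adj′ ρ s x
        exit-or-next reached Cu (inj₂ v-short) onward = inj₂ (onward v-short)
        exit-or-next reached Cu (inj₁ exit-short) onward with exit-spec Cu
        ... | u~y , y~t , y≢c = inj₁
          (step (step reached (clear-of-c (centre≢c Cu) y≢c u~y) exit-short)
            (clear-of-c y≢c (c≢t ∘ ≡-sym) y~t) t-short)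

        advance : ∀ {z ws next} (W : Walk z ws) → ρ (first-central W) ≡ short →
          HitBy ρ (b , entrance W) → All (HitBy ρ) (exitPairs next ws) →
          Conn adj′ ρ s t ⊎ Conn adj′ ρ s z
        advance (enter _ s~b′ b′~z Cz) z-short (inj₁ b-short) _ = inj₂
          (step (step here (clear-of-c (c≢s ∘ ≡-sym) (border≢c s~b) s~b) b-short)
            (clear-of-c (border≢c s~b) (centre≢c Cz) (dominates Cz)) z-short)
        advance (enter _ s~b′ b′~z Cz) z-short (inj₂ b′-short) _ = inj₂
          (step (step here (clear-of-c (c≢s ∘ ≡-sym) (border≢c s~b′) s~b′) b′-short)
            (clear-of-c (border≢c s~b′) (centre≢c Cz) b′~z) z-short)
        -- The skipped head concerns leaving `z`; the pair for leaving `w` towards `z` heads the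
        -- remaining list.
        advance (extend W w~z Cz) z₁-short b-hit (_ ∷ hits) with advance W z₁-short b-hit hits
        ... | inj₁ won = inj₁ won
        ... | inj₂ reached = exit-or-next reached Cw (exitPairs-head W hits)
          (step reached (clear-of-c (centre≢c Cw) (centre≢c Cz) w~z))
          where
          Cw = walk-end-central W

        finish : ρ z₁ ≡ short → HitBy ρ (b , b′) → All (HitBy ρ) (exitPairs c ws) →
          Conn adj′ ρ s t
        finish z₁-short b-hit hits with advance W z₁-short b-hit hits
        ... | inj₁ won = won
        ... | inj₂ reached = [ id , id ]′
          (exit-or-next reached Cz (exitPairs-head W hits) λ c-short →
            step (step reached (clear-of-b (centre≢b Cz) (target≢b c~t) z~c) c-short)
              (clear-of-b (target≢b c~t) (b≢t ∘ ≡-sym) c~t) t-short)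
          where
          Cz = walk-end-central W

    -- The edges from borders and centre to Γ(t), with b the only partner of c, form a matching.
    Matched : V → V → Set
    Matched x y = Near x × x ~ y × y ~ t × (y ≡ c → x ≡ b)

    near? : ∀ x → Dec (Near x)
    near? x with centre? x
    ... | inj₁ refl = no λ { (border s~s) → ~-irrefl s~s ; (central Cs) → ≢s Cs refl }
    ... | inj₂ (inj₁ refl) = no λ { (border s~t) → s≁t b≢s b≢t s~b s~t ; (central Ct) → ≢t Ct refl }
    ... | inj₂ (inj₂ (inj₁ s~x)) = yes (border s~x)
    ... | inj₂ (inj₂ (inj₂ (inj₁ x~t))) = no λ Nx → near-≁t Nx x~t
    ... | inj₂ (inj₂ (inj₂ (inj₂ Cx))) = yes (central Cx)

    matched? : ∀ x y → Dec (Matched x y)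
    matched? x y = near? x ×-dec (x ~? y) ×-dec (y ~? t) ×-dec ((y ≟ c) →-dec (x ≟ b))

    near≢t : ∀ {x} → Near x → x ≢ t
    near≢t (border s~t) refl = s≁t b≢s b≢t s~b s~t
    near≢t (central Ct) = ≢t Ct

    near≢s : ∀ {x} → Near x → x ≢ s
    near≢s (border s~s) refl = ~-irrefl s~s
    near≢s (central Cs) = ≢s Cs

    target-≢s : ∀ {x} → x ~ t → x ≢ s
    target-≢s s~t refl = s≁t b≢s b≢t s~b s~t

    matched-right : ∀ {x y y′} → Matched x y → Matched x y′ → y ≡ y′
    matched-right (border s~x , x~y , y~t , _) (_ , x~y′ , y′~t , _) =
      source-fork (near≢t (border s~x)) s~x x~y x~y′ y~t y′~t
    -- A central vertex is not `b`, so neither partner can be `c` and `centre-fork` applies.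
    matched-right (central Cx , x~y , y~t , y≡c) (_ , x~y′ , y′~t , y′≡c) =
      centre-fork Cx x~y x~y′ y~t y′~t (x≢b ∘ y≡c) (x≢b ∘ y′≡c)
      where
      x≢b = separated (s ~_) s~b (¬s~ Cx) ∘ ≡-sym

    matched-left : ∀ {x x′ y} → Matched x y → Matched x′ y → x ≡ x′
    matched-left {y = y} (Nx , x~y , y~t , y≡c) (Nx′ , x′~y , _ , y≡c′) with y ≟ c
    ... | yes refl = trans (y≡c refl) (≡-sym (y≡c′ refl))
    ... | no y≢c = target-fork Nx Nx′ x~y x′~y y~t y≢c

    matching : Pairing (n G)
    matching = record
      { Paired = λ x y → Matched x y ⊎ Matched y x
      ; symmetric = [ inj₂ , inj₁ ]′
      ; functional = λ
          { (inj₁ xy) (inj₁ xy′) → matched-right xy xy′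
          ; (inj₂ yx) (inj₂ y′x) → matched-left yx y′x
          ; (inj₁ (Nx , _)) (inj₂ (_ , _ , x~t , _)) → contradiction x~t (near-≁t Nx)
          ; (inj₂ (_ , _ , x~t , _)) (inj₁ (Nx , _)) → contradiction x~t (near-≁t Nx) }
      ; irreflexive = [ irr , irr ]′
      ; partner? = λ x → any? λ y → matched? x y ⊎-dec matched? y x
      }
      where
      irr : ∀ {x} → ¬ Matched x x
      irr (_ , x~x , _) = ~-irrefl x~x

    -- Invariant: where Short can get from s once Cut holds a vertex of every matched pair.
    data Reach (ρ : State (n G)) : V → Set where
      at-source : Reach ρ s
      at-border : ∀ {v} → s ~ v → ρ v ≡ short → Reach ρ v
      at-centre : ∀ {v} → Centre v → ρ v ≡ short → ρ b ≡ short ⊎ Linked v → Reach ρ v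

    -- The only neighbour of `t` that might be entered is `c`. From a border it is adjacent to `b`
    -- alone; from the centre, either Short holds `b` and Cut has `c`, or `linked-≁c` excludes the
    -- edge.
    reach-step : ∀ {ρ v w} → Answered matching short cut ρ → Reach ρ v → v ~ w → ρ w ≡ short →
      Reach ρ w
    reach-step {ρ} ans = go
      where
      blocked : ∀ {x y} → Matched x y → ρ x ≡ short → ρ y ≢ short
      blocked xy x-short y-short =
        case trans (≡-sym y-short) (ans _ _ (inj₁ xy) x-short) of λ ()

      near-target : ∀ {v w} → Near v → ρ v ≡ short → v ~ w → w ~ t → ρ w ≡ short →
        w ≡ c × v ≢ b
      near-target {v} {w} Nv v-short v~w w~t w-short with w ≟ c | v ≟ b
      ... | yes w≡c | no v≢b = w≡c , v≢b
      ... | no w≢c | _ =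
        contradiction w-short (blocked (Nv , v~w , w~t , λ w≡c → contradiction w≡c w≢c) v-short)
      ... | yes _ | yes v≡b = contradiction w-short (blocked (Nv , v~w , w~t , λ _ → v≡b) v-short)

      go : ∀ {v w} → Reach ρ v → v ~ w → ρ w ≡ short → Reach ρ w
      go at-source s~w w-short = at-border s~w w-short
      go {v} {w} (at-border s~v v-short) v~w w-short with centre? w
      ... | inj₁ refl = at-source
      ... | inj₂ (inj₁ refl) = contradiction v~w (borders-disjoint s~v)
      ... | inj₂ (inj₂ (inj₁ s~w)) = at-border s~w w-short
      ... | inj₂ (inj₂ (inj₂ (inj₁ w~t))) with near-target (border s~v) v-short v~w w~t w-short
      ...   | refl , v≢b = contradiction (source-neighbour-of-c s~v v~w) v≢b
      go {v} {w} (at-border s~v v-short) v~w w-short | inj₂ (inj₂ (inj₂ (inj₂ Cw))) with v ≟ b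
      ... | yes refl = at-centre Cw w-short (inj₁ v-short)
      ... | no v≢b = at-centre Cw w-short (inj₂ (_ , enter v≢b s~v v~w Cw , [] ∷ []))
      go {v} {w} (at-centre Cv v-short how) v~w w-short with centre? w
      ... | inj₁ refl = at-source
      ... | inj₂ (inj₁ refl) = contradiction v~w (¬~t Cv)
      ... | inj₂ (inj₂ (inj₁ s~w)) = at-border s~w w-short
      ... | inj₂ (inj₂ (inj₂ (inj₂ Cw))) =
        at-centre Cw w-short ([ inj₁ , (λ linked → inj₂ (link-extend linked v~w Cw)) ]′ how)
      ... | inj₂ (inj₂ (inj₂ (inj₁ w~t))) with near-target (central Cv) v-short v~w w~t w-short
      ...   | refl , _ with how
      ...     | inj₁ b-short =
        contradiction w-short (blocked (border s~b , b~c , c~t , λ _ → refl) b-short)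
      ...     | inj₂ linked = contradiction v~w (linked-≁c linked)

    -- Paired vertices all start free, so Cut's invariant holds initially. It confines Short to
    -- `Reach`, which does not contain `t`, contradicting his win as first player.
    absurd : ⊥
    absurd = cut-pairing-strategy matching
      (λ ρ ans conn → not-at-target (reach ans conn))
      (λ x y xy x-short → contradiction x-short (unclaimed xy))
      short-first
      where
      reach : ∀ {ρ v} → Answered matching short cut ρ → Conn (adj G) ρ s v → Reach ρ v
      reach ans here = at-source
      reach ans (step conn v~w w-short) = reach-step ans (reach ans conn) v~w w-short
      not-at-target : ∀ {ρ} → ¬ Reach ρ t
      not-at-target = at t refl
        where
        at : ∀ {ρ} v → v ≡ t → ¬ Reach ρ v
        at _ s≡t at-source = s≢t s≡t
        at _ refl (at-border s~t _) = s≁t b≢s b≢t s~b s~t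
        at _ v≡t (at-centre Cv _ _) = ≢t Cv v≡t
      unclaimed : ∀ {x y} → Paired matching x y → initial s t x ≢ short
      unclaimed xy x-short =
        case trans (≡-sym x-short) (initial-free (proj₁ (nonterminal xy)) (proj₂ (nonterminal xy))) of λ ()
        where
        nonterminal : ∀ {x y} → Paired matching x y → x ≢ s × x ≢ t
        nonterminal (inj₁ (Nx , _)) = near≢s Nx , near≢t Nx
        nonterminal (inj₂ (_ , _ , x~t , _)) = target-≢s x~t , ~⇒≢ x~t

  -- Cases for the neighbours of a border vertex at `s`

  source-border-bound : ∀ {b} → s ~ b → b ≢ t → Bound b
  source-border-bound {b} s~b b≢t with b ~? t
  -- The repeated `t` pads the list to the required length three.
  ... | yes b~t = few-neighbours-bound (s ∷ t ∷ b ∷ []) (s ∷ t ∷ t ∷ []) (ℕₚ.m≤m+n 3 2) refl at0 at1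
          (through-one s~b b~t) neighbour
    where
    neighbour : ∀ u → b ~ u → u ∈ s ∷ t ∷ t ∷ []
    neighbour u b~u with u ∈? (s ∷ t ∷ b ∷ [])
    ... | yes at0 = at0
    ... | yes at1 = at1
    ... | yes at2 = contradiction b~u ~-irrefl
    ... | no u∉ = contradiction (~-sym b~u) (through-one s~b b~t u∉)
  ... | no ¬b~t with any? (λ c → (b ~? c) ×-dec (c ~? t))
  ...   | no none = (λ _ → ≤-trans bound (ℕₚ.+-monoʳ-≤ (centreSize G s t) (s≤s z≤n))) , (λ _ → bound)
    where
    neighbour : ∀ u → b ~ u → Centre u ⊎ u ∈ s ∷ []
    neighbour u b~u with centre? u
    ... | inj₁ refl = inj₂ at0
    ... | inj₂ (inj₁ refl) = contradiction b~u ¬b~t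
    ... | inj₂ (inj₂ (inj₁ s~u)) = contradiction b~u (source-border-independent s~b s~u)
    ... | inj₂ (inj₂ (inj₂ (inj₁ u~t))) = contradiction (u , b~u , u~t) none
    ... | inj₂ (inj₂ (inj₂ (inj₂ Cu))) = inj₁ Cu
    bound : degree G b ≤ centreSize G s t + 1
    bound = degree-bound [] (s ∷ []) 1 [] refl (λ ()) neighbour
  ...   | yes (c , b~c , c~t) with any? (λ x → ¬? (x ≟ c) ×-dec (b ~? x) ×-dec (x ~? t))
  ...     | yes (x , x≢c , b~x , x~t) =
    few-neighbours-bound (s ∷ t ∷ b ∷ x ∷ c ∷ []) (s ∷ x ∷ c ∷ []) ≤-refl refl at0 at1
      fork neighbour
    where
    fork : Isolated (s ∷ t ∷ b ∷ x ∷ c ∷ [])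
    fork = fork-to-target b≢t s~b b~x b~c x~t c~t x≢c
    neighbour : ∀ u → b ~ u → u ∈ s ∷ x ∷ c ∷ []
    neighbour u b~u with u ∈? (s ∷ t ∷ b ∷ x ∷ c ∷ [])
    ... | yes at0 = at0
    ... | yes at1 = contradiction b~u ¬b~t
    ... | yes at2 = contradiction b~u ~-irrefl
    ... | yes at3 = at1
    ... | yes at4 = at2
    ... | no u∉ = contradiction (~-sym b~u) (fork u∉)
  ...     | no other = (λ _ → degree-bound [] (s ∷ c ∷ []) 2 [] refl (λ ()) neighbour) , strong
    where
    only-c : ∀ {x} → b ~ x → x ~ t → x ≡ c
    only-c {x} b~x x~t = decidable-stable (x ≟ c) λ x≢c → other (x , x≢c , b~x , x~t)
    neighbour : ∀ u → b ~ u → Centre u ⊎ u ∈ s ∷ c ∷ []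
    neighbour u b~u with centre? u
    ... | inj₁ refl = inj₂ at0
    ... | inj₂ (inj₁ refl) = contradiction b~u ¬b~t
    ... | inj₂ (inj₂ (inj₁ s~u)) = contradiction b~u (source-border-independent s~b s~u)
    ... | inj₂ (inj₂ (inj₂ (inj₁ u~t))) = inj₂ (there (here (only-c b~u u~t)))
    ... | inj₂ (inj₂ (inj₂ (inj₂ Cu))) = inj₁ Cu
    strong : 5 < weight G → degree G b ≤ centreSize G s t + 1
    -- A central vertex missed by `b` would lower the bound by one, so exceeding it forces `b` to be
    -- adjacent to the whole centre.
    strong 5<w = decidable-stable (_ ℕₚ.≤? _) λ exceeds →
      Dominating.absurd s~b ¬b~t b≢t b~c c~t only-c
        (λ {z} Cz → decidable-stable (b ~? z) λ ¬b~z → exceeds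
          (degree-bound (z ∷ []) (s ∷ c ∷ []) 1 ([] ∷ []) refl
            (λ { (here refl) → Cz , ¬b~z }) neighbour))
        (<-∸2 5<w)

-- Exchanging the terminals

isCentre-swap : (G : Graph) (s t v : Fin (n G)) → isCentre G s t v ≡ isCentre G t s v
isCentre-swap G s t v
  rewrite ∨-comm (does (v ≟ s)) (does (v ≟ t)) | ∨-comm (adj G s v) (adj G t v) = refl

isBorder⇒adjacent : (G : Graph) (s t v : Fin (n G)) → isBorder G s t v ≡ true →
  v ≢ s × v ≢ t × (adj G s v ≡ true ⊎ adj G t v ≡ true)
isBorder⇒adjacent G s t v border with v ≟ s | v ≟ t | adj G s v | adj G t v
... | no v≢s | no v≢t | true | _ = v≢s , v≢t , inj₁ refl
... | no v≢s | no v≢t | false | true = v≢s , v≢t , inj₂ refl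

theorem2 : (G : Graph) (s t : Fin (n G)) → s ≢ t → MinimalWeakLink G s t →
    (b : Fin (n G)) → isBorder G s t b ≡ true →
    (3 < weight G → degree G b ≤ centreSize G s t + 2) ×
    (5 < weight G → degree G b ≤ centreSize G s t + 1)
theorem2 G s t s≢t ((short-first , _) , minimal) b border with isBorder⇒adjacent G s t b border
... | b≢s , b≢t , inj₁ s~b = Link.source-border-bound G s t s≢t short-first minimal s~b b≢t
-- Reversing paths exchanges the terminals, both in the link and in each graph with an edge deleted,
-- so minimality carries over.
... | b≢s , b≢t , inj₂ t~b rewrite count-cong (isCentre-swap G s t) =
  Link.source-border-bound G t s (s≢t ∘ ≡-sym) (first-swap (sym G) short-first)
    (λ a b a~b → minimal a b a~b ∘ first-swap (deleteEdge-sym (adj G) (sym G) a b)) t~b b≢s
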